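{- Let $\mathbb{F}$ be a field of characteristic zero and let $\varepsilon > 0$ be a fixed constant. There is an explicit sequence of polynomial maps $\mathcal{G} = (\mathcal{G}_n : \mathbb{F}^{n - n^{1-\varepsilon}} \to \mathbb{F}^n)_{n \in \mathbb{N}}$ such that $\mathcal{G}$ is a $\mathsf{VNC}^0$-computable hitting set generator for $\mathsf{VAC}^0$.
   Context: An arithmetic circuit over $\mathbb{F}$ is a directed acyclic graph whose in-degree-zero vertices (input gates) are labeled by variables or field constants and whose other vertices (internal gates) are labeled $+$ or $\times$; its size is the number of internal gates and its depth is the length of the longest input-to-output path. A $p$-family is a sequence of polynomials $(f_n)_{n\in\mathbb{N}}$ over $\mathbb{F}$ with $\deg f_n$ polynomially bounded in $n$. $\mathsf{VAC}^0$ is the class of $p$-families $(f_n)$ such that $f_n$ is computable by an arithmetic circuit of size $n^{O(1)}$ and depth $O(1)$. $\mathsf{VNC}^0$ is the class of $p$-families $(f_n)$ such that $f_n$ is computable by an arithmetic circuit of size $O(1)$. For a sequence of polynomial maps $\mathcal{G} = (\mathcal{G}_n : \mathbb{F}^{\ell(n)} \to \mathbb{F}^n)_{n}$ with $\mathcal{G}_n = (g_{n,1},\ldots,g_{n,n})$, and classes $\mathscr{C},\mathscr{D}$ of $p$-families, $\mathcal{G}$ is a $\mathscr{D}$-computable hitting set generator for $\mathscr{C}$ if (1) every $p$-family of the form $(g_{n,i_n})_{n}$ lies in $\mathscr{D}$, and (2) for every $p$-family $(f_n)_n \in \mathscr{C}$ and all sufficiently large $n$, $f_n \circ \mathcal{G}_{m(n)}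 = 0$ if and only if $f_n = 0$, where $m(n)$ is the number of variables of $f_n$.
   Formalization: p-families are additionally required to have a number of variables m(n) polynomially related to n (n ≤ m(n)^{O(1)}); otherwise the claim fails, e.g. for m(n)=1, where G_1 is a constant c and x_1 − c is annihilated. -}

module Defs where

open import Level using (Level; _⊔_) renaming (suc to lsuc)
open import Algebra.Bundles using (CommutativeRing)
open import Data.Nat using (ℕ; zero; suc; _∸_; _^_; _≤_)
  renaming (_+_ to _+ℕ_; _*_ to _*ℕ_; _⊔_ to _⊔ℕ_)
open import Data.Fin using (Fin)
open import Data.Vec using (Vec; []; _∷ʳ_; lookup)
open import Data.List using (List; foldr; map; length)
open import Data.Product using (Σ; _×_; ∃; ∃-syntax; _,_)
open import Relation.Nullary using (¬_)

record Field (c ℓ : Level) : Set (lsuc (c ⊔ ℓ)) where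
  field
    commutativeRing : CommutativeRing c ℓ
  open CommutativeRing commutativeRing public
  field
    1≉0     : ¬ (1# ≈ 0#)
    inverse : ∀ x → ¬ (x ≈ 0#) → ∃ λ y → (x * y) ≈ 1#

module _ {c ℓ : Level} (F : Field c ℓ) where
  open Field F using (Carrier; _≈_; _+_; _*_; -_; 0#; 1#)

  natMul : ℕ → Carrier
  natMul zero    = 0#
  natMul (suc n) = 1# + natMul n

  CharZero : Set ℓ
  CharZero = ∀ n → ¬ (natMul (suc n) ≈ 0#)

  -- Polynomials in m variables over F: F[x_0,…,x_{m-1}] presented as
  -- expressions modulo the commutative F-algebra axioms (free
  -- commutative F-algebra on m generators).

  data Expr (m : ℕ) : Set c where
    var  : Fin m → Expr m
    con  : Carrier → Expr m
    _⊕_  : Expr m → Expr m → Expr m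
    _⊗_  : Expr m → Expr m → Expr m

  infixl 6 _⊕_
  infixl 7 _⊗_
  infix  4 _≈ₚ_

  data _≈ₚ_ {m : ℕ} : Expr m → Expr m → Set (c ⊔ ℓ) where
    ≈-refl   : ∀ {e} → e ≈ₚ e
    ≈-sym    : ∀ {e f} → e ≈ₚ f → f ≈ₚ e
    ≈-trans  : ∀ {e f g} → e ≈ₚ f → f ≈ₚ g → e ≈ₚ g
    ⊕-cong   : ∀ {e e' f f'} → e ≈ₚ e' → f ≈ₚ f' → e ⊕ f ≈ₚ e' ⊕ f'
    ⊗-cong   : ∀ {e e' f f'} → e ≈ₚ e' → f ≈ₚ f' → e ⊗ f ≈ₚ e' ⊗ f'
    ⊕-assoc  : ∀ {e f g} → (e ⊕ f) ⊕ g ≈ₚ e ⊕ (f ⊕ g)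
    ⊕-comm   : ∀ {e f} → e ⊕ f ≈ₚ f ⊕ e
    ⊕-idˡ    : ∀ {e} → con 0# ⊕ e ≈ₚ e
    ⊕-invʳ   : ∀ {e} → e ⊕ (con (- 1#) ⊗ e) ≈ₚ con 0#
    ⊗-assoc  : ∀ {e f g} → (e ⊗ f) ⊗ g ≈ₚ e ⊗ (f ⊗ g)
    ⊗-comm   : ∀ {e f} → e ⊗ f ≈ₚ f ⊗ e
    ⊗-idˡ    : ∀ {e} → con 1# ⊗ e ≈ₚ e
    ⊗-distribˡ : ∀ {e f g} → e ⊗ (f ⊕ g) ≈ₚ (e ⊗ f) ⊕ (e ⊗ g)
    con-+    : ∀ {a b} → con a ⊕ con b ≈ₚ con (a + b)
    con-*    : ∀ {a b} → con a ⊗ con b ≈ₚ con (a * b)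
    con-cong : ∀ {a b} → a ≈ b → con a ≈ₚ con b

  0ₚ : ∀ {m} → Expr m
  0ₚ = con 0#

  substₚ : ∀ {m k} → Expr m → (Fin m → Expr k) → Expr k
  substₚ (var i) σ = σ i
  substₚ (con a) σ = con a
  substₚ (e ⊕ f) σ = substₚ e σ ⊕ substₚ f σ
  substₚ (e ⊗ f) σ = substₚ e σ ⊗ substₚ f σ

  synDeg : ∀ {m} → Expr m → ℕ
  synDeg (var _) = 1
  synDeg (con _) = 0
  synDeg (e ⊕ f) = synDeg e ⊔ℕ synDeg f
  synDeg (e ⊗ f) = synDeg e +ℕ synDeg f

  -- deg f ≤ D  (the degree of a polynomial is the least syntactic degree
  -- of an expression representing it)
  Deg≤ : ∀ {m} → Expr m → ℕ → Set (c ⊔ ℓ)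
  Deg≤ f D = Σ (Expr _) λ e → e ≈ₚ f × synDeg e ≤ D

  -- Arithmetic circuits (DAGs, unbounded fan-in) as straight-line
  -- programs: gate number k may only read gates 0,…,k-1.

  data Gate (m k : ℕ) : Set c where
    inVar   : Fin m → Gate m k
    inConst : Carrier → Gate m k
    addG    : List (Fin k) → Gate m k
    mulG    : List (Fin k) → Gate m k

  data Circuit (m : ℕ) : ℕ → Set c where
    []  : Circuit m 0
    _▷_ : ∀ {k} → Circuit m k → Gate m k → Circuit m (suc k)

  gateVal : ∀ {m k} → Vec (Expr m) k → Gate m k → Expr m
  gateVal vs (inVar i)   = var i
  gateVal vs (inConst a) = con a
  gateVal vs (addG is)   = foldr (λ i acc → lookup vs i ⊕ acc) (con 0#) is
  gateVal vs (mulG is)   = foldr (λ i acc → lookup vs i ⊗ acc) (con 1#) is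

  vals : ∀ {m k} → Circuit m k → Vec (Expr m) k
  vals []      = []
  vals (C ▷ g) = vals C ∷ʳ gateVal (vals C) g

  gateDepth : ∀ {m k} → Vec ℕ k → Gate m k → ℕ
  gateDepth ds (inVar _)   = 0
  gateDepth ds (inConst _) = 0
  gateDepth ds (addG is)   = suc (foldr (λ i acc → lookup ds i ⊔ℕ acc) 0 is)
  gateDepth ds (mulG is)   = suc (foldr (λ i acc → lookup ds i ⊔ℕ acc) 0 is)

  depths : ∀ {m k} → Circuit m k → Vec ℕ k
  depths []      = []
  depths (C ▷ g) = depths C ∷ʳ gateDepth (depths C) g

  gateSize : ∀ {m k} → Gate m k → ℕ
  gateSize (inVar _)   = 0
  gateSize (inConst _) = 0
  gateSize (addG _)    = 1
  gateSize (mulG _)    = 1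

  gateFanIn : ∀ {m k} → Gate m k → ℕ
  gateFanIn (inVar _)   = 0
  gateFanIn (inConst _) = 0
  gateFanIn (addG is)   = length is
  gateFanIn (mulG is)   = length is

  size : ∀ {m k} → Circuit m k → ℕ
  size []      = 0
  size (C ▷ g) = size C +ℕ gateSize g

  maxFanIn : ∀ {m k} → Circuit m k → ℕ
  maxFanIn []      = 0
  maxFanIn (C ▷ g) = maxFanIn C ⊔ℕ gateFanIn g

  output : ∀ {m k} → Circuit m (suc k) → Expr m
  output (C ▷ g) = gateVal (vals C) g

  depth : ∀ {m k} → Circuit m (suc k) → ℕ
  depth (C ▷ g) = gateDepth (depths C) g

  Computes : ∀ {m k} → Circuit m (suc k) → Expr m → Set (c ⊔ ℓ)
  Computes C f = output C ≈ₚ f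

  PolyBounded : (ℕ → ℕ) → Set
  PolyBounded b = ∃[ a ] (∀ n → b n ≤ a *ℕ n ^ a +ℕ a)

  IsPFamily : (m : ℕ → ℕ) → ((n : ℕ) → Expr (m n)) → Set (c ⊔ ℓ)
  IsPFamily m f =
      PolyBounded m
    × (∃[ a ] (∀ n → n ≤ a *ℕ m n ^ a +ℕ a))
    × (∃[ a ] (∀ n → Deg≤ (f n) (a *ℕ n ^ a +ℕ a)))

  VAC⁰ : (m : ℕ → ℕ) → ((n : ℕ) → Expr (m n)) → Set (c ⊔ ℓ)
  VAC⁰ m f = IsPFamily m f ×
    (∃[ a ] ∃[ d ] (∀ n → ∃[ k ] Σ (Circuit (m n) (suc k)) λ C →
        Computes C (f n) × size C ≤ a *ℕ n ^ a +ℕ a × depth C ≤ d))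

  -- constant size (and constant fan-in, as NC⁰ is bounded fan-in)
  VNC⁰ : (m : ℕ → ℕ) → ((n : ℕ) → Expr (m n)) → Set (c ⊔ ℓ)
  VNC⁰ m f = IsPFamily m f ×
    (∃[ a ] (∀ n → ∃[ k ] Σ (Circuit (m n) (suc k)) λ C →
        Computes C (f n) × size C ≤ a × maxFanIn C ≤ a))

  IsVNC⁰HSGforVAC⁰ : (sl : ℕ → ℕ) → ((n : ℕ) → Fin n → Expr (sl n)) → Set (c ⊔ ℓ)
  IsVNC⁰HSGforVAC⁰ sl G =
      (∀ (i : (n : ℕ) → Fin (suc n)) →
         VNC⁰ (λ n → sl (suc n)) (λ n → G (suc n) (i n)))
    × (∀ (m : ℕ → ℕ) (f : (n : ℕ) → Expr (m n)) → VAC⁰ m f →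
         ∃[ N ] (∀ n → N ≤ n →
           ((substₚ (f n) (G (m n)) ≈ₚ 0ₚ → f n ≈ₚ 0ₚ)
            × (f n ≈ₚ 0ₚ → substₚ (f n) (G (m n)) ≈ₚ 0ₚ))))

-- seed length ℓ(n) ≤ n - n^{1-ε} with ε = p/q  (for n ≥ 1):
--   n - ℓ(n) ≥ n^{(q-p)/q}  ⟺  (n - ℓ(n))^q · n^{p∸q} ≥ n^{q∸p}
SeedBound : (p q : ℕ) → (ℕ → ℕ) → Set
SeedBound p q ℓ = ∀ n → ℓ n ≤ n × (1 ≤ n → n ^ (q ∸ p) ≤ (n ∸ ℓ n) ^ q *ℕ n ^ (p ∸ q))

{-# OPTIONS --safe #-}

-- The generator consists of monomials. Its outputs are cut into blocks of k + 1 ≈ n^(1/q) / 2,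
-- and a block is a chain x₀², x₀ x₁², x₁ x₂², …, x_{k-1} in k seeds. Every binomial relation
-- in a block has degree at least 2ᵏ: the exponent map is injective on vectors of weight below
-- 2ᵏ. So a polynomial of degree below 2ᵏ keeps all its coefficients, at relocated monomials,
-- under composition with the generator; since k grows like a power of n, this covers every
-- p-family for large n, whatever its circuit complexity, and lower bounds are not needed.
-- Fields here need not have decidable equality, so polynomials are handled through linear
-- functionals on monomials instead of normal forms: the functional that decodes a monomial
-- respects _≈ₚ_ and inverts the composition in low degree.

module Submission where

open import Defs
open import Level using (Level; _⊔_)
open import Algebra.Bundles using (CommutativeSemigroup)
import Algebra.Properties.CommutativeSemigroup
open import Data.Fin using (Fin; zero; suc; _↑ˡ_; _↑ʳ_; splitAt)
open import Data.Fin.Properties using (splitAt⁻¹-↑ˡ; splitAt⁻¹-↑ʳ)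
open import Data.List as List using (List; []; _∷_; length; foldr)
open import Data.List.Properties using (length-map)
open import Data.Nat
  using (ℕ; zero; suc; _+_; _*_; _∸_; _^_; _≤_; _<_; z≤n; s≤s; s≤s⁻¹; ⌊_/2⌋; NonZero; >-nonZero)
open import Data.Nat.DivMod
  using (_/_; _%_; m≡m%n+[m/n]*n; m/n*n≤m; m%n<n; m<n⇒m%n≡m; n%1≡0; [m+kn]%n≡m%n)
open import Data.Nat.Properties
open import Data.Nat.Tactic.RingSolver using (solve-∀)
open import Data.Product using (Σ; _×_; _,_; proj₁; proj₂; ∃-syntax)
open import Data.Sum using (_⊎_; inj₁; inj₂)
open import Data.Vec using (Vec; []; _∷_; _++_; head; take; drop; replicate; zipWith; sum)
open import Data.Vec.Properties
  using ( zipWith-++; zipWith-replicate; zipWith-assoc; zipWith-comm; take-zipWith; drop-zipWith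
        ; take++drop≡id; sum-++; ++-injectiveˡ; ++-injectiveʳ)
open import Function using (id; _∘_)
open import Relation.Binary.Bundles using (Setoid)
open import Relation.Binary.PropositionalEquality
  using (_≡_; refl; sym; trans; cong; cong₂; subst; subst₂; module ≡-Reasoning)
import Relation.Binary.Reasoning.Setoid
open import Relation.Nullary using (yes; no; contradiction)

-- Exponent vectors.

𝟘 : ∀ {n} → Vec ℕ n
𝟘 = replicate _ 0

infixl 6 _∙_
_∙_ : ∀ {n} → Vec ℕ n → Vec ℕ n → Vec ℕ n
_∙_ = zipWith _+_

δ : ∀ {n} → Fin n → Vec ℕ n
δ zero    = 1 ∷ 𝟘
δ (suc i) = 0 ∷ δ i

exponents : ∀ {n} → List (Fin n) → Vec ℕ n
exponents = foldr (λ i → δ i ∙_) 𝟘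

sum-𝟘 : ∀ n → sum (𝟘 {n}) ≡ 0
sum-𝟘 zero    = refl
sum-𝟘 (suc n) = sum-𝟘 n

sum-δ : ∀ {n} (i : Fin n) → sum (δ i) ≡ 1
sum-δ {suc n} zero = cong suc (sum-𝟘 n)
sum-δ (suc i)      = sum-δ i

sum-∙ : ∀ {n} (u v : Vec ℕ n) → sum (u ∙ v) ≡ sum u + sum v
sum-∙ []      []      = refl
sum-∙ (x ∷ u) (y ∷ v) rewrite sum-∙ u v = interchange x y (sum u) (sum v)
  where
  interchange : ∀ a b c d → a + b + (c + d) ≡ a + c + (b + d)
  interchange = solve-∀

𝟘++𝟘 : ∀ m {n} → 𝟘 {m} ++ 𝟘 {n} ≡ 𝟘
𝟘++𝟘 zero    = refl
𝟘++𝟘 (suc m) = cong (0 ∷_) (𝟘++𝟘 m)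

δ-↑ˡ : ∀ {m} n (i : Fin m) → δ (i ↑ˡ n) ≡ δ i ++ 𝟘
δ-↑ˡ {suc m} n zero    = cong (1 ∷_) (sym (𝟘++𝟘 m))
δ-↑ˡ         n (suc i) = cong (0 ∷_) (δ-↑ˡ n i)

δ-↑ʳ : ∀ m {n} (i : Fin n) → δ (m ↑ʳ i) ≡ 𝟘 {m} ++ δ i
δ-↑ʳ zero    i = refl
δ-↑ʳ (suc m) i = cong (0 ∷_) (δ-↑ʳ m i)

∙-𝟘𝟘 : ∀ n → 𝟘 {n} ∙ 𝟘 ≡ 𝟘
∙-𝟘𝟘 n = zipWith-replicate {n = n} _+_ 0 0

exponents-↑ˡ : ∀ {m} n (is : List (Fin m)) →
  exponents (List.map (_↑ˡ n) is) ≡ exponents is ++ 𝟘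
exponents-↑ˡ {m} n []   = sym (𝟘++𝟘 m)
exponents-↑ˡ {m} n (i ∷ is) = begin
  δ (i ↑ˡ n) ∙ exponents (List.map (_↑ˡ n) is) ≡⟨ cong₂ _∙_ (δ-↑ˡ n i) (exponents-↑ˡ n is) ⟩
  (δ i ++ 𝟘) ∙ (exponents is ++ 𝟘)             ≡⟨ zipWith-++ _+_ (δ i) 𝟘 (exponents is) 𝟘 ⟩
  exponents (i ∷ is) ++ (𝟘 ∙ 𝟘)                ≡⟨ cong (exponents (i ∷ is) ++_) (∙-𝟘𝟘 n) ⟩
  exponents (i ∷ is) ++ 𝟘                      ∎
  where open ≡-Reasoning

exponents-↑ʳ : ∀ m {n} (is : List (Fin n)) →
  exponents (List.map (m ↑ʳ_) is) ≡ 𝟘 {m} ++ exponents is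
exponents-↑ʳ m []   = sym (𝟘++𝟘 m)
exponents-↑ʳ m (i ∷ is) = begin
  δ (m ↑ʳ i) ∙ exponents (List.map (m ↑ʳ_) is) ≡⟨ cong₂ _∙_ (δ-↑ʳ m i) (exponents-↑ʳ m is) ⟩
  (𝟘 ++ δ i) ∙ (𝟘 {m} ++ exponents is)         ≡⟨ zipWith-++ _+_ (𝟘 {m}) (δ i) 𝟘 (exponents is) ⟩
  (𝟘 {m} ∙ 𝟘) ++ exponents (i ∷ is)            ≡⟨ cong (_++ exponents (i ∷ is)) (∙-𝟘𝟘 m) ⟩
  𝟘 {m} ++ exponents (i ∷ is)                  ∎
  where open ≡-Reasoning

-- Monomial maps and their direct sums.

-- `enc` is the linear map that the monomials induce on exponents. Its injectivity in low weight is
-- given as a left inverse, because `dec` itself is later fed to a functional; outside the range of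
-- `dec-enc` its values are arbitrary.
record MonomialMap (bound n ℓ : ℕ) : Set where
  field
    factors       : Fin n → List (Fin ℓ)
    factors-short : ∀ i → length (factors i) ≤ 3
    enc           : Vec ℕ n → Vec ℕ ℓ
    enc-𝟘         : enc 𝟘 ≡ 𝟘
    enc-∙         : ∀ u v → enc (u ∙ v) ≡ enc u ∙ enc v
    enc-δ         : ∀ i → enc (δ i) ≡ exponents (factors i)
    dec           : Vec ℕ ℓ → Vec ℕ n
    dec-enc       : ∀ u → sum u < bound → dec (enc u) ≡ u

module _ where
  open MonomialMap

  identityMap : ∀ bound n → MonomialMap bound n n
  identityMap bound n .factors       = List.[_]
  identityMap bound n .factors-short i = s≤s z≤n
  identityMap bound n .enc           = id
  identityMap bound n .enc-𝟘         = refl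
  identityMap bound n .enc-∙ u v     = refl
  identityMap bound n .enc-δ         = δ≡ where
    δ≡ : ∀ {n} (i : Fin n) → δ i ≡ δ i ∙ 𝟘
    δ≡ {suc n} zero = cong (1 ∷_) (sym (∙-𝟘𝟘 n))
    δ≡ (suc i)      = cong (0 ∷_) (δ≡ i)
  identityMap bound n .dec           = id
  identityMap bound n .dec-enc u _   = refl

  module _ {bound n₁ ℓ₁ n₂ ℓ₂ : ℕ} (A : MonomialMap bound n₁ ℓ₁) (B : MonomialMap bound n₂ ℓ₂) where

    private
      encAB : Vec ℕ (n₁ + n₂) → Vec ℕ (ℓ₁ + ℓ₂)
      encAB u = enc A (take n₁ u) ++ enc B (drop n₁ u)

      decAB : Vec ℕ (ℓ₁ + ℓ₂) → Vec ℕ (n₁ + n₂)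
      decAB w = dec A (take ℓ₁ w) ++ dec B (drop ℓ₁ w)

      take-++ : ∀ {m n} (a : Vec ℕ m) (b : Vec ℕ n) → take m (a ++ b) ≡ a
      take-++ {m} a b = ++-injectiveˡ _ a (take++drop≡id m (a ++ b))

      drop-++ : ∀ {m n} (a : Vec ℕ m) (b : Vec ℕ n) → drop m (a ++ b) ≡ b
      drop-++ {m} a b = ++-injectiveʳ (take m (a ++ b)) a (take++drop≡id m (a ++ b))

      encAB-++ : ∀ a b → encAB (a ++ b) ≡ enc A a ++ enc B b
      encAB-++ a b = cong₂ (λ x y → enc A x ++ enc B y) (take-++ a b) (drop-++ a b)

      factorsAB : Fin (n₁ + n₂) → List (Fin (ℓ₁ + ℓ₂))
      factorsAB i with splitAt n₁ i
      ... | inj₁ j = List.map (_↑ˡ ℓ₂) (factors A j)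
      ... | inj₂ j = List.map (ℓ₁ ↑ʳ_) (factors B j)

    -- Each part of a vector weighs at most as much as the whole, so `bound` does not shrink however
    -- many blocks are joined.
    directSum : MonomialMap bound (n₁ + n₂) (ℓ₁ + ℓ₂)
    directSum .factors = factorsAB
    directSum .factors-short i with splitAt n₁ i
    ... | inj₁ j rewrite length-map (_↑ˡ ℓ₂) (factors A j) = factors-short A j
    ... | inj₂ j rewrite length-map (ℓ₁ ↑ʳ_) (factors B j) = factors-short B j
    directSum .enc = encAB
    directSum .enc-𝟘 = begin
      encAB 𝟘              ≡⟨ cong encAB (𝟘++𝟘 n₁) ⟨
      encAB (𝟘 {n₁} ++ 𝟘)  ≡⟨ encAB-++ 𝟘 𝟘 ⟩
      enc A 𝟘 ++ enc B 𝟘   ≡⟨ cong₂ _++_ (enc-𝟘 A) (enc-𝟘 B) ⟩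
      𝟘 {ℓ₁} ++ 𝟘          ≡⟨ 𝟘++𝟘 ℓ₁ ⟩
      𝟘                    ∎
      where open ≡-Reasoning
    directSum .enc-∙ u v = begin
      encAB (u ∙ v)
        ≡⟨ cong₂ (λ x y → enc A x ++ enc B y) (take-zipWith _+_ u v) (drop-zipWith _+_ u v) ⟩
      enc A (take n₁ u ∙ take n₁ v) ++ enc B (drop n₁ u ∙ drop n₁ v)
        ≡⟨ cong₂ _++_ (enc-∙ A _ _) (enc-∙ B _ _) ⟩
      (enc A (take n₁ u) ∙ enc A (take n₁ v)) ++ (enc B (drop n₁ u) ∙ enc B (drop n₁ v))
        ≡⟨ zipWith-++ _+_ (enc A (take n₁ u)) _ (enc A (take n₁ v)) _ ⟨
      encAB u ∙ encAB v ∎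
      where open ≡-Reasoning
    directSum .enc-δ i with splitAt n₁ i in eq
    ... | inj₁ j = begin
      encAB (δ i)                            ≡⟨ cong (encAB ∘ δ) (splitAt⁻¹-↑ˡ eq) ⟨
      encAB (δ (j ↑ˡ n₂))                    ≡⟨ cong encAB (δ-↑ˡ n₂ j) ⟩
      encAB (δ j ++ 𝟘)                       ≡⟨ encAB-++ (δ j) 𝟘 ⟩
      enc A (δ j) ++ enc B 𝟘                 ≡⟨ cong₂ _++_ (enc-δ A j) (enc-𝟘 B) ⟩
      exponents (factors A j) ++ 𝟘           ≡⟨ exponents-↑ˡ ℓ₂ (factors A j) ⟨
      exponents (List.map (_↑ˡ ℓ₂) (factors A j)) ∎
      where open ≡-Reasoning
    ... | inj₂ j = begin
      encAB (δ i)                            ≡⟨ cong (encAB ∘ δ) (splitAt⁻¹-↑ʳ {n₁} eq) ⟨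
      encAB (δ (n₁ ↑ʳ j))                    ≡⟨ cong encAB (δ-↑ʳ n₁ j) ⟩
      encAB (𝟘 {n₁} ++ δ j)                  ≡⟨ encAB-++ 𝟘 (δ j) ⟩
      enc A 𝟘 ++ enc B (δ j)                 ≡⟨ cong₂ _++_ (enc-𝟘 A) (enc-δ B j) ⟩
      𝟘 {ℓ₁} ++ exponents (factors B j)      ≡⟨ exponents-↑ʳ ℓ₁ (factors B j) ⟨
      exponents (List.map (ℓ₁ ↑ʳ_) (factors B j)) ∎
      where open ≡-Reasoning
    directSum .dec = decAB
    directSum .dec-enc u u<bound = begin
      decAB (encAB u)
        ≡⟨ cong₂ (λ x y → dec A x ++ dec B y)
                 (take-++ (enc A (take n₁ u)) _) (drop-++ (enc A (take n₁ u)) _) ⟩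
      dec A (enc A (take n₁ u)) ++ dec B (enc B (drop n₁ u))
        ≡⟨ cong₂ _++_ (dec-enc A _ (≤-<-trans (m≤m+n _ _) parts<))
                      (dec-enc B _ (≤-<-trans (m≤n+m _ (sum (take n₁ u))) parts<)) ⟩
      take n₁ u ++ drop n₁ u
        ≡⟨ take++drop≡id n₁ u ⟩
      u ∎
      where
      open ≡-Reasoning
      parts< : sum (take n₁ u) + sum (drop n₁ u) < bound
      parts< = subst (_< bound) (trans (cong sum (sym (take++drop≡id n₁ u))) (sum-++ (take n₁ u))) u<bound

-- Chain blocks and their decoding.

-- The chain y₀ = x₀², yᵢ = xᵢ₋₁ xᵢ², y_k = x_{k-1}: its exponent matrix has the kernel
-- spanned by (1, -2, 4, …, ±2ᵏ), so only exponents of size 2ᵏ and above can collide.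

chainFactors : ∀ k → Fin (suc k) → List (Fin k)
chainFactors zero    zero          = []
chainFactors (suc k) zero          = zero ∷ zero ∷ []
chainFactors (suc k) (suc zero)    = zero ∷ List.map suc (chainFactors k zero)
chainFactors (suc k) (suc (suc i)) = List.map suc (chainFactors k (suc i))

chainEnc : ∀ {k} → Vec ℕ (suc k) → Vec ℕ k
chainEnc (v ∷ [])      = []
chainEnc (v ∷ v′ ∷ vs) = v + v + v′ ∷ chainEnc (v′ ∷ vs)

-- r is the residue of the first exponent modulo suc M; each equation w = 2 v + v′ turns
-- a residue of v modulo suc M into one of v′ modulo 2 (suc M) = suc (suc (M + M)).
chainDec : ∀ {k} → ℕ → ℕ → Vec ℕ k → Vec ℕ (suc k)
chainDec M r []       = r ∷ []
chainDec M r (w ∷ ws) = ⌊ w ∸ head vs /2⌋ ∷ vs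
  where vs = chainDec (suc (M + M)) ((w + r * (M + M)) % suc (suc (M + M))) ws

chainFactors-short : ∀ k i → length (chainFactors k i) ≤ 3
chainFactors-short zero    zero          = z≤n
chainFactors-short (suc k) zero          = s≤s (s≤s z≤n)
chainFactors-short (suc zero) (suc zero) = s≤s z≤n
chainFactors-short (suc (suc k)) (suc zero) = ≤-refl
chainFactors-short (suc k) (suc (suc i)) =
  ≤-trans (≤-reflexive (length-map suc (chainFactors k (suc i)))) (chainFactors-short k (suc i))

chainEnc-𝟘 : ∀ k → chainEnc (𝟘 {suc k}) ≡ 𝟘
chainEnc-𝟘 zero    = refl
chainEnc-𝟘 (suc k) = cong (0 ∷_) (chainEnc-𝟘 k)

chainEnc-∙ : ∀ {k} (u v : Vec ℕ (suc k)) → chainEnc (u ∙ v) ≡ chainEnc u ∙ chainEnc v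
chainEnc-∙ (x ∷ [])     (y ∷ [])     = refl
chainEnc-∙ (x ∷ x′ ∷ u) (y ∷ y′ ∷ v) = cong₂ _∷_ (additive x y x′ y′) (chainEnc-∙ (x′ ∷ u) (y′ ∷ v))
  where
  additive : ∀ a b c d → a + b + (a + b) + (c + d) ≡ a + a + c + (b + b + d)
  additive = solve-∀

exponents-suc : ∀ {n} (is : List (Fin n)) → exponents (List.map suc is) ≡ 0 ∷ exponents is
exponents-suc []       = refl
exponents-suc (i ∷ is) rewrite exponents-suc is = refl

∙-identityˡ : ∀ {n} (u : Vec ℕ n) → 𝟘 ∙ u ≡ u
∙-identityˡ []      = refl
∙-identityˡ (x ∷ u) = cong (x ∷_) (∙-identityˡ u)

chainEnc-δ : ∀ k i → chainEnc (δ i) ≡ exponents (chainFactors k i)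
chainEnc-δ zero    zero = refl
chainEnc-δ (suc k) zero = cong (2 ∷_) (begin
  chainEnc 𝟘  ≡⟨ chainEnc-𝟘 k ⟩
  𝟘           ≡⟨ ∙-𝟘𝟘 k ⟨
  𝟘 ∙ 𝟘       ≡⟨ cong (𝟘 ∙_) (∙-𝟘𝟘 k) ⟨
  𝟘 ∙ (𝟘 ∙ 𝟘) ∎)
  where open ≡-Reasoning
chainEnc-δ (suc k) (suc zero)
  rewrite exponents-suc (chainFactors k zero) | ∙-identityˡ (exponents (chainFactors k zero))
  = cong (1 ∷_) (chainEnc-δ k zero)
chainEnc-δ (suc k) (suc (suc i))
  rewrite exponents-suc (chainFactors k (suc i))
  = cong (0 ∷_) (chainEnc-δ k (suc i))

-- Going down the chain the known modulus doubles at each step. At the last exponent it exceeds the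
-- total weight, so the residue is the exponent itself; the earlier exponents then follow by
-- back-substitution.
chainDec-enc : ∀ {k} M v (vs : Vec ℕ k) → sum (v ∷ vs) < suc M * 2 ^ k →
  chainDec M (v % suc M) (chainEnc (v ∷ vs)) ≡ v ∷ vs
chainDec-enc M v [] v< =
  cong (_∷ []) (m<n⇒m%n≡m (subst₂ _<_ (+-identityʳ v) (*-identityʳ (suc M)) v<))
chainDec-enc {suc k} M v (v′ ∷ vs) v< = trans (cong step tail≡) (cong (_∷ v′ ∷ vs) first≡)
  where
  r = v % suc M
  q = v / suc M
  w = v + v + v′

  step : Vec ℕ (suc k) → Vec ℕ (suc (suc k))
  step us = ⌊ w ∸ head us /2⌋ ∷ us

  -- `r * (M + M)` stands for -2 r modulo 2 (M + 1), which avoids truncated subtraction.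
  collect : ∀ r q M v′ → (r + q * suc M) + (r + q * suc M) + v′ + r * (M + M)
                       ≡ v′ + (q + r) * suc (suc (M + M))
  collect = solve-∀

  residue : (w + r * (M + M)) % suc (suc (M + M)) ≡ v′ % suc (suc (M + M))
  residue = begin
    (w + r * (M + M)) % N
      ≡⟨ cong (λ x → (x + x + v′ + r * (M + M)) % N) (m≡m%n+[m/n]*n v (suc M)) ⟩
    ((r + q * suc M) + (r + q * suc M) + v′ + r * (M + M)) % N
      ≡⟨ cong (_% N) (collect r q M v′) ⟩
    (v′ + (q + r) * N) % N
      ≡⟨ [m+kn]%n≡m%n v′ (q + r) N ⟩
    v′ % N ∎
    where
    open ≡-Reasoning
    N = suc (suc (M + M))

  -- The doubled modulus absorbs one factor 2 of the power, so the weight bound passes to the tail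
  -- unchanged.
  double : ∀ M x → suc M * (2 * x) ≡ suc (suc (M + M)) * x
  double = solve-∀

  tail≡ : chainDec (suc (M + M)) ((w + r * (M + M)) % suc (suc (M + M))) (chainEnc (v′ ∷ vs)) ≡ v′ ∷ vs
  tail≡ rewrite residue = chainDec-enc (suc (M + M)) v′ vs
    (≤-<-trans (m≤n+m (v′ + sum vs) v) (subst (v + (v′ + sum vs) <_) (double M (2 ^ k)) v<))

  first≡ : ⌊ w ∸ v′ /2⌋ ≡ v
  first≡ = trans (cong ⌊_/2⌋ (m+n∸n≡m (v + v) v′)) (sym (n≡⌊n+n/2⌋ v))

chainMap : ∀ k → MonomialMap (2 ^ k) (suc k) k
chainMap k = record
  { factors       = chainFactors k
  ; factors-short = chainFactors-short k
  ; enc           = chainEnc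
  ; enc-𝟘         = chainEnc-𝟘 k
  ; enc-∙         = chainEnc-∙
  ; enc-δ         = chainEnc-δ k
  -- Decoding starts from no information: modulus 1, residue 0.
  ; dec           = chainDec 0 0
  ; dec-enc       = λ { (v ∷ vs) v< → subst (λ r → chainDec 0 r (chainEnc (v ∷ vs)) ≡ v ∷ vs) (n%1≡0 v)
                        (chainDec-enc 0 v vs (subst (sum (v ∷ vs) <_) (sym (*-identityˡ (2 ^ k))) v<)) }
  }

-- The recursion matches the indices of `directSum` definitionally, so `blockMap` needs no casts.
outputs seeds : (blocks k rest : ℕ) → ℕ
outputs zero    k rest = rest
outputs (suc B) k rest = suc k + outputs B k rest
seeds zero    k rest = rest
seeds (suc B) k rest = k + seeds B k rest

blockMap : ∀ B k rest → MonomialMap (2 ^ k) (outputs B k rest) (seeds B k rest)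
blockMap zero    k rest = identityMap (2 ^ k) rest
blockMap (suc B) k rest = directSum (chainMap k) (blockMap B k rest)

-- Linear functionals on monomials.

module Expansion {c ℓ′ : Level} (F : Field c ℓ′) where
  open Field F using (Carrier; 0#; 1#; -_) renaming (_+_ to _+F_; -‿inverseʳ to +F-inverseʳ)

  -- ⟦ e ⟧ h is the sum of a · h(u) over the terms a yᵘ of e expanded without collecting.
  ⟦_⟧ : ∀ {m k} → Expr F m → (Vec ℕ m → Expr F k) → Expr F k
  ⟦ var i ⟧ h = h (δ i)
  ⟦ con a ⟧ h = con a ⊗ h 𝟘
  ⟦ e ⊕ f ⟧ h = ⟦ e ⟧ h ⊕ ⟦ f ⟧ h
  ⟦ e ⊗ f ⟧ h = ⟦ e ⟧ (λ u → ⟦ f ⟧ (λ v → h (u ∙ v)))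

  infix 4 _≋_
  _≋_ : ∀ {k} → Expr F k → Expr F k → Set (c ⊔ ℓ′)
  _≋_ = _≈ₚ_ F

  setoid : ℕ → Setoid c (c ⊔ ℓ′)
  setoid k = record
    { Carrier = Expr F k ; _≈_ = _≋_
    ; isEquivalence = record { refl = ≈-refl ; sym = ≈-sym ; trans = ≈-trans } }

  ⊕-commutativeSemigroup : ℕ → CommutativeSemigroup c (c ⊔ ℓ′)
  ⊕-commutativeSemigroup k = record
    { Carrier = Expr F k ; _≈_ = _≋_ ; _∙_ = _⊕_
    ; isCommutativeSemigroup = record
      { isSemigroup = record
        { isMagma = record { isEquivalence = Setoid.isEquivalence (setoid k) ; ∙-cong = ⊕-cong }
        ; assoc = λ _ _ _ → ⊕-assoc }
      ; comm = λ _ _ → ⊕-comm } }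

  ⊗-commutativeSemigroup : ℕ → CommutativeSemigroup c (c ⊔ ℓ′)
  ⊗-commutativeSemigroup k = record
    { Carrier = Expr F k ; _≈_ = _≋_ ; _∙_ = _⊗_
    ; isCommutativeSemigroup = record
      { isSemigroup = record
        { isMagma = record { isEquivalence = Setoid.isEquivalence (setoid k) ; ∙-cong = ⊗-cong }
        ; assoc = λ _ _ _ → ⊗-assoc }
      ; comm = λ _ _ → ⊗-comm } }

  module _ {k : ℕ} where
    open Relation.Binary.Reasoning.Setoid (setoid k)
    private
      module ⊕ = Algebra.Properties.CommutativeSemigroup (⊕-commutativeSemigroup k)
      module ⊗ = Algebra.Properties.CommutativeSemigroup (⊗-commutativeSemigroup k)

    ≡⇒≋ : ∀ {e f : Expr F k} → e ≡ f → e ≋ f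
    ≡⇒≋ refl = ≈-refl

    ⊕-congˡ : {e f g : Expr F k} → f ≋ g → e ⊕ f ≋ e ⊕ g
    ⊕-congˡ = ⊕-cong ≈-refl

    ⊗-congˡ : {e f g : Expr F k} → f ≋ g → e ⊗ f ≋ e ⊗ g
    ⊗-congˡ = ⊗-cong ≈-refl

    ⊗-idʳ : {e : Expr F k} → e ⊗ con 1# ≋ e
    ⊗-idʳ = ≈-trans ⊗-comm ⊗-idˡ

    ⊗-distribʳ : {e f g : Expr F k} → (e ⊕ f) ⊗ g ≋ (e ⊗ g) ⊕ (f ⊗ g)
    ⊗-distribʳ = ≈-trans ⊗-comm (≈-trans ⊗-distribˡ (⊕-cong ⊗-comm ⊗-comm))

    zeroʳ : (e : Expr F k) → e ⊗ 0ₚ F ≋ 0ₚ F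
    zeroʳ e = begin
      e ⊗ con 0#                        ≈⟨ ⊗-congˡ (con-cong (+F-inverseʳ 1#)) ⟨
      e ⊗ con (1# +F - 1#)              ≈⟨ ⊗-congˡ con-+ ⟨
      e ⊗ (con 1# ⊕ con (- 1#))         ≈⟨ ⊗-distribˡ ⟩
      (e ⊗ con 1#) ⊕ (e ⊗ con (- 1#))   ≈⟨ ⊕-cong ⊗-idʳ ⊗-comm ⟩
      e ⊕ (con (- 1#) ⊗ e)              ≈⟨ ⊕-invʳ ⟩
      con 0#                            ∎

    zeroˡ : (e : Expr F k) → 0ₚ F ⊗ e ≋ 0ₚ F
    zeroˡ e = ≈-trans ⊗-comm (zeroʳ e)

    -- Every monomial in the expansion of `e` has weight at most `synDeg F e`. This is how a degree
    -- bound lets a decoder that is correct only in low weight be used.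
    ⟦⟧-cong≤ : ∀ {m} (e : Expr F m) {h h′ : Vec ℕ m → Expr F k} →
      (∀ u → sum u ≤ synDeg F e → h u ≋ h′ u) → ⟦ e ⟧ h ≋ ⟦ e ⟧ h′
    ⟦⟧-cong≤ (var i) h≋h′ = h≋h′ (δ i) (≤-reflexive (sum-δ i))
    ⟦⟧-cong≤ {m} (con a) h≋h′ = ⊗-congˡ (h≋h′ 𝟘 (≤-reflexive (sum-𝟘 m)))
    ⟦⟧-cong≤ (e ⊕ f) h≋h′ =
      ⊕-cong (⟦⟧-cong≤ e λ u u≤ → h≋h′ u (m≤n⇒m≤n⊔o _ u≤))
             (⟦⟧-cong≤ f λ u u≤ → h≋h′ u (m≤n⇒m≤o⊔n _ u≤))
    ⟦⟧-cong≤ (e ⊗ f) h≋h′ =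
      ⟦⟧-cong≤ e λ u u≤ → ⟦⟧-cong≤ f λ v v≤ →
        h≋h′ (u ∙ v) (subst (_≤ _) (sym (sum-∙ u v)) (+-mono-≤ u≤ v≤))

    ⟦⟧-cong : ∀ {m} (e : Expr F m) {h h′ : Vec ℕ m → Expr F k} →
      (∀ u → h u ≋ h′ u) → ⟦ e ⟧ h ≋ ⟦ e ⟧ h′
    ⟦⟧-cong e h≋h′ = ⟦⟧-cong≤ e (λ u _ → h≋h′ u)

    ⟦⟧-⊕ : ∀ {m} (e : Expr F m) (h h′ : Vec ℕ m → Expr F k) →
      ⟦ e ⟧ (λ u → h u ⊕ h′ u) ≋ ⟦ e ⟧ h ⊕ ⟦ e ⟧ h′
    ⟦⟧-⊕ (var i) h h′ = ≈-refl
    ⟦⟧-⊕ (con a) h h′ = ⊗-distribˡ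
    ⟦⟧-⊕ (e ⊕ f) h h′ = ≈-trans (⊕-cong (⟦⟧-⊕ e h h′) (⟦⟧-⊕ f h h′)) (⊕.interchange _ _ _ _)
    ⟦⟧-⊕ (e ⊗ f) h h′ =
      ≈-trans (⟦⟧-cong e λ u → ⟦⟧-⊕ f (λ v → h (u ∙ v)) (λ v → h′ (u ∙ v))) (⟦⟧-⊕ e _ _)

    ⟦⟧-⊗ˡ : ∀ {m} (e : Expr F m) (t : Expr F k) (h : Vec ℕ m → Expr F k) →
      ⟦ e ⟧ (λ u → t ⊗ h u) ≋ t ⊗ ⟦ e ⟧ h
    ⟦⟧-⊗ˡ (var i) t h = ≈-refl
    ⟦⟧-⊗ˡ (con a) t h = ⊗.x∙yz≈y∙xz _ _ _
    ⟦⟧-⊗ˡ (e ⊕ f) t h = ≈-trans (⊕-cong (⟦⟧-⊗ˡ e t h) (⟦⟧-⊗ˡ f t h)) (≈-sym ⊗-distribˡ)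
    ⟦⟧-⊗ˡ (e ⊗ f) t h =
      ≈-trans (⟦⟧-cong e λ u → ⟦⟧-⊗ˡ f t (λ v → h (u ∙ v))) (⟦⟧-⊗ˡ e t _)

    -- Interchange of two finite sums; it yields the commutativity case of `⟦⟧-sound`.
    ⟦⟧-swap : ∀ {m m′} (e : Expr F m) (f : Expr F m′) (h : Vec ℕ m → Vec ℕ m′ → Expr F k) →
      ⟦ e ⟧ (λ u → ⟦ f ⟧ (h u)) ≋ ⟦ f ⟧ (λ v → ⟦ e ⟧ (λ u → h u v))
    ⟦⟧-swap (var i)  f h = ≈-refl
    ⟦⟧-swap (con a)  f h = ≈-sym (⟦⟧-⊗ˡ f (con a) (h 𝟘))
    ⟦⟧-swap (e ⊕ e′) f h =
      ≈-trans (⊕-cong (⟦⟧-swap e f h) (⟦⟧-swap e′ f h)) (≈-sym (⟦⟧-⊕ f _ _))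
    ⟦⟧-swap (e ⊗ e′) f h =
      ≈-trans (⟦⟧-cong e λ u → ⟦⟧-swap e′ f (λ v → h (u ∙ v))) (⟦⟧-swap e f _)

    -- Each algebra axiom reduces to linearity, interchange of sums or a monoid law for exponents.
    -- Since `h` need not be multiplicative, this covers functionals that are not substitutions,
    -- such as the one built from `dec`.
    ⟦⟧-sound : ∀ {m} {e f : Expr F m} → e ≋ f → (h : Vec ℕ m → Expr F k) → ⟦ e ⟧ h ≋ ⟦ f ⟧ h
    ⟦⟧-sound ≈-refl          h = ≈-refl
    ⟦⟧-sound (≈-sym p)       h = ≈-sym (⟦⟧-sound p h)
    ⟦⟧-sound (≈-trans p q)   h = ≈-trans (⟦⟧-sound p h) (⟦⟧-sound q h)
    ⟦⟧-sound (⊕-cong p q)    h = ⊕-cong (⟦⟧-sound p h) (⟦⟧-sound q h)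
    ⟦⟧-sound (⊗-cong {e} p q) h =
      ≈-trans (⟦⟧-cong e λ u → ⟦⟧-sound q (λ v → h (u ∙ v))) (⟦⟧-sound p _)
    ⟦⟧-sound ⊕-assoc         h = ⊕-assoc
    ⟦⟧-sound ⊕-comm          h = ⊕-comm
    ⟦⟧-sound ⊕-idˡ           h = ≈-trans (⊕-cong (zeroˡ _) ≈-refl) ⊕-idˡ
    ⟦⟧-sound (⊕-invʳ {e})    h = begin
      ⟦ e ⟧ h ⊕ (con (- 1#) ⊗ ⟦ e ⟧ (λ v → h (𝟘 ∙ v)))
        ≈⟨ ⊕-congˡ (⊗-congˡ (⟦⟧-cong e λ v → ≡⇒≋ (cong h (∙-identityˡ v)))) ⟩
      ⟦ e ⟧ h ⊕ (con (- 1#) ⊗ ⟦ e ⟧ h)  ≈⟨ ⊕-invʳ ⟩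
      con 0#                            ≈⟨ zeroˡ (h 𝟘) ⟨
      con 0# ⊗ h 𝟘                      ∎
    ⟦⟧-sound (⊗-assoc {e} {f} {g}) h =
      ⟦⟧-cong e λ u → ⟦⟧-cong f λ v → ⟦⟧-cong g λ w → ≡⇒≋ (cong h (zipWith-assoc +-assoc u v w))
    ⟦⟧-sound (⊗-comm {e} {f}) h =
      ≈-trans (⟦⟧-swap e f (λ u v → h (u ∙ v)))
              (⟦⟧-cong f λ v → ⟦⟧-cong e λ u → ≡⇒≋ (cong h (zipWith-comm +-comm u v)))
    ⟦⟧-sound (⊗-idˡ {e})     h =
      ≈-trans ⊗-idˡ (⟦⟧-cong e λ v → ≡⇒≋ (cong h (∙-identityˡ v)))
    ⟦⟧-sound (⊗-distribˡ {e}) h = ⟦⟧-⊕ e _ _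
    ⟦⟧-sound con-+           h = ≈-trans (≈-sym ⊗-distribʳ) (⊗-cong con-+ ≈-refl)
    ⟦⟧-sound {m} con-*       h =
      ≈-trans (⊗-congˡ (⊗-congˡ (≡⇒≋ (cong h (∙-𝟘𝟘 m)))))
              (≈-trans (≈-sym ⊗-assoc) (⊗-cong con-* ≈-refl))
    ⟦⟧-sound (con-cong p)    h = ⊗-cong (con-cong p) ≈-refl

    -- Substitution as an expansion.

    infixr 8 _↑_
    _↑_ : Expr F k → ℕ → Expr F k
    t ↑ zero  = con 1#
    t ↑ suc n = t ⊗ t ↑ n

    ↑-+ : ∀ t m n → t ↑ (m + n) ≋ t ↑ m ⊗ t ↑ n
    ↑-+ t zero    n = ≈-sym ⊗-idˡ
    ↑-+ t (suc m) n = ≈-trans (⊗-congˡ (↑-+ t m n)) (≈-sym ⊗-assoc)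

    monomial : ∀ {m} → (Fin m → Expr F k) → Vec ℕ m → Expr F k
    monomial σ []      = con 1#
    monomial σ (n ∷ u) = σ zero ↑ n ⊗ monomial (λ i → σ (suc i)) u

    monomial-𝟘 : ∀ {m} (σ : Fin m → Expr F k) → monomial σ 𝟘 ≋ con 1#
    monomial-𝟘 {zero}  σ = ≈-refl
    monomial-𝟘 {suc m} σ = ≈-trans ⊗-idˡ (monomial-𝟘 (λ i → σ (suc i)))

    monomial-∙ : ∀ {m} (σ : Fin m → Expr F k) u v → monomial σ (u ∙ v) ≋ monomial σ u ⊗ monomial σ v
    monomial-∙ σ []      []      = ≈-sym ⊗-idˡ
    monomial-∙ σ (a ∷ u) (b ∷ v) =
      ≈-trans (⊗-cong (↑-+ (σ zero) a b) (monomial-∙ (λ i → σ (suc i)) u v)) (⊗.interchange _ _ _ _)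

    monomial-δ : ∀ {m} (σ : Fin m → Expr F k) i → monomial σ (δ i) ≋ σ i
    monomial-δ σ zero    = ≈-trans (⊗-cong ⊗-idʳ (monomial-𝟘 (λ i → σ (suc i)))) ⊗-idʳ
    monomial-δ σ (suc i) = ≈-trans ⊗-idˡ (monomial-δ (λ i → σ (suc i)) i)

    -- `monomial σ` is multiplicative, so in a product the inner sum does not depend on the outer
    -- exponent and can be pulled out by linearity.
    ⟦⟧-monomial : ∀ {m} (σ : Fin m → Expr F k) (e : Expr F m) → ⟦ e ⟧ (monomial σ) ≋ substₚ F e σ
    ⟦⟧-monomial σ (var i) = monomial-δ σ i
    ⟦⟧-monomial σ (con a) = ≈-trans (⊗-congˡ (monomial-𝟘 σ)) ⊗-idʳ
    ⟦⟧-monomial σ (e ⊕ f) = ⊕-cong (⟦⟧-monomial σ e) (⟦⟧-monomial σ f)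
    ⟦⟧-monomial σ (e ⊗ f) = begin
      ⟦ e ⟧ (λ u → ⟦ f ⟧ (λ v → monomial σ (u ∙ v)))
        ≈⟨ (⟦⟧-cong e λ u → ≈-trans (⟦⟧-cong f (monomial-∙ σ u)) (⟦⟧-⊗ˡ f (monomial σ u) _)) ⟩
      ⟦ e ⟧ (λ u → monomial σ u ⊗ ⟦ f ⟧ (monomial σ))  ≈⟨ ⟦⟧-cong e (λ u → ⊗-comm) ⟩
      ⟦ e ⟧ (λ u → ⟦ f ⟧ (monomial σ) ⊗ monomial σ u)  ≈⟨ ⟦⟧-⊗ˡ e _ _ ⟩
      ⟦ f ⟧ (monomial σ) ⊗ ⟦ e ⟧ (monomial σ)          ≈⟨ ⊗-comm ⟩
      ⟦ e ⟧ (monomial σ) ⊗ ⟦ f ⟧ (monomial σ)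
        ≈⟨ ⊗-cong (⟦⟧-monomial σ e) (⟦⟧-monomial σ f) ⟩
      substₚ F e σ ⊗ substₚ F f σ                      ∎

  substₚ-var : ∀ {m} (e : Expr F m) → substₚ F e var ≡ e
  substₚ-var (var i) = refl
  substₚ-var (con a) = refl
  substₚ-var (e ⊕ f) rewrite substₚ-var e | substₚ-var f = refl
  substₚ-var (e ⊗ f) rewrite substₚ-var e | substₚ-var f = refl

  substₚ-cong : ∀ {m k} {e f : Expr F m} (σ : Fin m → Expr F k) → e ≋ f → substₚ F e σ ≋ substₚ F f σ
  substₚ-cong {e = e} {f} σ e≋f =
    ≈-trans (≈-sym (⟦⟧-monomial σ e)) (≈-trans (⟦⟧-sound e≋f (monomial σ)) (⟦⟧-monomial σ f))

  -- Composition with a monomial generator.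

  product : ∀ {ℓ} → List (Fin ℓ) → Expr F ℓ
  product = foldr (λ j acc → var j ⊗ acc) (con 1#)

  synDeg-product : ∀ {ℓ} (js : List (Fin ℓ)) → synDeg F (product js) ≡ length js
  synDeg-product []       = refl
  synDeg-product (j ∷ js) = cong suc (synDeg-product js)

  ⟦⟧-product : ∀ {ℓ k} (js : List (Fin ℓ)) (h : Vec ℕ ℓ → Expr F k) →
    ⟦ product js ⟧ h ≋ h (exponents js)
  ⟦⟧-product []       h = ⊗-idˡ
  ⟦⟧-product (j ∷ js) h = ⟦⟧-product js (λ v → h (δ j ∙ v))

  -- One multiplication gate over input gates, which do not count towards size. Splitting on the
  -- length makes the output compute to the product, so `≈-refl` suffices.
  productCircuit : ∀ {ℓ} (js : List (Fin ℓ)) → length js ≤ 3 →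
    ∃[ k ] Σ (Circuit F ℓ (suc k)) λ C →
      Computes F C (product js) × size F C ≤ 1 × maxFanIn F C ≤ 3
  productCircuit [] _ = _ , ([] ▷ mulG []) , ≈-refl , s≤s z≤n , z≤n
  productCircuit (a ∷ []) _ =
    _ , (([] ▷ inVar a) ▷ mulG (zero ∷ [])) , ≈-refl , s≤s z≤n , s≤s z≤n
  productCircuit (a ∷ b ∷ []) _ =
    _ , ((([] ▷ inVar a) ▷ inVar b) ▷ mulG (zero ∷ suc zero ∷ []))
      , ≈-refl , s≤s z≤n , s≤s (s≤s z≤n)
  productCircuit (a ∷ b ∷ c ∷ []) _ =
    _ , (((([] ▷ inVar a) ▷ inVar b) ▷ inVar c) ▷ mulG (zero ∷ suc zero ∷ suc (suc zero) ∷ []))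
      , ≈-refl , s≤s z≤n , s≤s (s≤s (s≤s z≤n))
  productCircuit (_ ∷ _ ∷ _ ∷ _ ∷ _) (s≤s (s≤s (s≤s ())))

  module _ {bound n ℓ : ℕ} (A : MonomialMap bound n ℓ) where
    open MonomialMap A

    generator : Fin n → Expr F ℓ
    generator i = product (factors i)

    -- Composition only relocates coefficients, from `u` to `enc u`; the product case is additivity
    -- of `enc`.
    ⟦⟧-generator : ∀ {k} (e : Expr F n) (h : Vec ℕ ℓ → Expr F k) →
      ⟦ substₚ F e generator ⟧ h ≋ ⟦ e ⟧ (λ u → h (enc u))
    ⟦⟧-generator (var i) h = ≈-trans (⟦⟧-product (factors i) h) (≡⇒≋ (cong h (sym (enc-δ i))))
    ⟦⟧-generator (con a) h = ⊗-congˡ (≡⇒≋ (cong h (sym enc-𝟘)))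
    ⟦⟧-generator (e ⊕ f) h = ⊕-cong (⟦⟧-generator e h) (⟦⟧-generator f h)
    ⟦⟧-generator (e ⊗ f) h =
      ≈-trans (⟦⟧-cong (substₚ F e generator) λ w → ⟦⟧-generator f (λ w′ → h (w ∙ w′)))
      (≈-trans (⟦⟧-generator e _)
               (⟦⟧-cong e λ u → ⟦⟧-cong f λ v → ≡⇒≋ (cong h (sym (enc-∙ u v)))))

    -- The functional `h` sends each monomial to its decoding. Applied to the composition it
    -- rebuilds `e`, all of whose monomials lie below `bound`; applied to zero it gives zero.
    generator-hits : (e : Expr F n) → synDeg F e < bound → substₚ F e generator ≋ 0ₚ F → e ≋ 0ₚ F
    generator-hits e e<bound eG≋0 = begin
      e                                        ≡⟨ substₚ-var e ⟨
      substₚ F e var                           ≈⟨ ⟦⟧-monomial var e ⟨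
      ⟦ e ⟧ (monomial var)
        ≈⟨ (⟦⟧-cong≤ e λ u u≤ → ≡⇒≋ (cong (monomial var) (sym (dec-enc u (≤-<-trans u≤ e<bound))))) ⟩
      ⟦ e ⟧ (λ u → h (enc u))                  ≈⟨ ⟦⟧-generator e h ⟨
      ⟦ substₚ F e generator ⟧ h               ≈⟨ ⟦⟧-sound eG≋0 h ⟩
      con 0# ⊗ h 𝟘                             ≈⟨ zeroˡ (h 𝟘) ⟩
      con 0#                                   ∎
      where
      open Relation.Binary.Reasoning.Setoid (setoid n)
      h : Vec ℕ ℓ → Expr F n
      h w = monomial var (dec w)

-- Block sizes and seed length.

outputs≡ : ∀ B k rest → outputs B k rest ≡ rest + B * suc k
outputs≡ zero    k rest = sym (+-identityʳ rest)
outputs≡ (suc B) k rest rewrite outputs≡ B k rest = rearrange k rest (B * suc k)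
  where
  rearrange : ∀ k r x → suc k + (r + x) ≡ r + (suc k + x)
  rearrange = solve-∀

outputs≡seeds+blocks : ∀ B k rest → outputs B k rest ≡ seeds B k rest + B
outputs≡seeds+blocks zero    k rest = sym (+-identityʳ rest)
outputs≡seeds+blocks (suc B) k rest rewrite outputs≡seeds+blocks B k rest =
  rearrange k (seeds B k rest) B
  where
  rearrange : ∀ k s B → suc k + (s + B) ≡ k + s + suc B
  rearrange = solve-∀

-- A block of positive width owns at least one seed. At width 0 its output is a constant and this
-- fails.
blocks≤seeds : ∀ B k rest → B ≤ seeds B (suc k) rest
blocks≤seeds zero    k rest = z≤n
blocks≤seeds (suc B) k rest = s≤s (≤-trans (blocks≤seeds B k rest) (m≤n+m _ k))

^-distribʳ-* : ∀ x y e → (x * y) ^ e ≡ x ^ e * y ^ e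
^-distribʳ-* x y zero    = refl
^-distribʳ-* x y (suc e) rewrite ^-distribʳ-* x y e = [m*n]*[o*p]≡[m*o]*[n*p] x y (x ^ e) (y ^ e)

n≤n^suc : ∀ n q → n ≤ n ^ suc q
n≤n^suc zero    q = z≤n
n≤n^suc (suc n) q = subst (_≤ suc n ^ suc q) (^-identityʳ (suc n)) (^-monoʳ-≤ (suc n) (s≤s (z≤n {q})))

-- With blocks of size b = k + 1, the factor 2 pays for the rounding in ⌊n / b⌋ ≥ n / (2 b).
rootWidth : ∀ q n → ∃[ k ] (k ≡ 0 ⊎ (2 * suc k) ^ suc q ≤ n) × n < (2 * suc (suc k)) ^ suc q
rootWidth q zero = 0 , inj₁ refl , m^n>0 4 (suc q)
rootWidth q (suc n) with rootWidth q n
... | k , small , n< with (2 * suc (suc k)) ^ suc q ≤? suc n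
...   | yes big = suc k , inj₂ big , ≤-<-trans n< (^-monoˡ-< (suc q) (*-monoʳ-< 2 (n<1+n (suc (suc k)))))
...   | no ¬big with small
...     | inj₁ k≡0 = k , inj₁ k≡0 , ≰⇒> ¬big
...     | inj₂ k≤  = k , inj₂ (m≤n⇒m≤1+n k≤) , ≰⇒> ¬big

module Layout (q : ℕ) where

  width blocks rest seedLength : ℕ → ℕ
  width n      = proj₁ (rootWidth q n)
  blocks n     = n / suc (width n)
  rest n       = n % suc (width n)
  seedLength n = seeds (blocks n) (width n) (rest n)

  outputs-layout : ∀ n → outputs (blocks n) (width n) (rest n) ≡ n
  outputs-layout n = trans (outputs≡ (blocks n) (width n) (rest n)) (sym (m≡m%n+[m/n]*n n (suc (width n))))

  n≡seeds+blocks : ∀ n → n ≡ seedLength n + blocks n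
  n≡seeds+blocks n = trans (sym (outputs-layout n)) (outputs≡seeds+blocks (blocks n) (width n) (rest n))

  layoutMap : ∀ n → MonomialMap (2 ^ width n) n (seedLength n)
  layoutMap n = subst (λ N → MonomialMap (2 ^ width n) N (seedLength n)) (outputs-layout n)
                      (blockMap (blocks n) (width n) (rest n))

  n<[2width]^ : ∀ n → n < (2 * suc (suc (width n))) ^ suc q
  n<[2width]^ n = proj₂ (proj₂ (rootWidth q n))

  n<suc-blocks*width : ∀ n → n < suc (blocks n) * suc (width n)
  n<suc-blocks*width n = subst (_< suc (blocks n) * suc (width n)) (sym (m≡m%n+[m/n]*n n (suc (width n))))
                            (+-monoˡ-< (blocks n * suc (width n)) (m%n<n n (suc (width n))))

  -- With block size b and B blocks, n ≤ 2 b B and (2 b)^(q+1) ≤ n give n^(q+1) ≤ n B^(q+1), and one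
  -- factor n cancels.
  n^q≤blocks^ : ∀ n → 1 ≤ n → n ^ q ≤ blocks n ^ suc q
  n^q≤blocks^ n@(suc _) _ with proj₁ (proj₂ (rootWidth q n))
  -- For small n the width is 0, and each output is a block of its own.
  ... | inj₁ k≡0 = ≤-trans (^-monoˡ-≤ q n≤B)
                     (^-monoʳ-≤ (blocks n) {{>-nonZero (≤-trans (s≤s z≤n) n≤B)}} (n≤1+n q))
    where
    n≤B : n ≤ blocks n
    n≤B = s≤s⁻¹ (subst (n <_) (trans (cong (λ k → suc (blocks n) * suc k) k≡0) (*-identityʳ _))
                      (n<suc-blocks*width n))
  ... | inj₂ [2b]^≤n = *-cancelˡ-≤ n (begin
      n * n ^ q                        ≤⟨ ^-monoˡ-≤ (suc q) n≤2bB ⟩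
      (2 * b * B) ^ suc q              ≡⟨ ^-distribʳ-* (2 * b) B (suc q) ⟩
      (2 * b) ^ suc q * B ^ suc q      ≤⟨ *-monoˡ-≤ (B ^ suc q) [2b]^≤n ⟩
      n * B ^ suc q                    ∎)
    where
    open ≤-Reasoning
    b = suc (width n)
    B = blocks n
    b≤n : b ≤ n
    b≤n = ≤-trans (m≤n*m b 2) (≤-trans (n≤n^suc (2 * b) q) [2b]^≤n)
    1≤B : 1 ≤ B
    1≤B with B | n<suc-blocks*width n
    ... | zero  | n<b = contradiction b≤n (<⇒≱ (subst (n <_) (+-identityʳ b) n<b))
    ... | suc _ | _   = s≤s z≤n
    n≤2bB : n ≤ 2 * b * B
    n≤2bB = begin
      n             ≤⟨ <⇒≤ (n<suc-blocks*width n) ⟩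
      suc B * b     ≤⟨ *-monoˡ-≤ b (+-monoˡ-≤ B 1≤B) ⟩
      (B + B) * b   ≡⟨ rearrange B b ⟩
      2 * b * B     ∎
      where
      rearrange : ∀ B b → (B + B) * b ≡ 2 * b * B
      rearrange = solve-∀

  -- Here ε = (p+1)/(q+1). The layout is made for ε = 1/(q+1), the smallest value with this
  -- denominator; a larger numerator only weakens the bound.
  seedBound : ∀ p → SeedBound (suc p) (suc q) seedLength
  seedBound p n = subst (seedLength n ≤_) (sym (n≡seeds+blocks n)) (m≤m+n _ _) , bound
    where
    open ≤-Reasoning
    n∸seeds : n ∸ seedLength n ≡ blocks n
    n∸seeds = trans (cong (_∸ seedLength n) (n≡seeds+blocks n)) (m+n∸m≡n (seedLength n) (blocks n))
    bound : 1 ≤ n → n ^ (q ∸ p) ≤ (n ∸ seedLength n) ^ suc q * n ^ (p ∸ q)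
    bound 1≤n = begin
      n ^ (q ∸ p)                                ≤⟨ ^-monoʳ-≤ n (m∸n≤m q p) ⟩
      n ^ q                                      ≤⟨ n^q≤blocks^ n 1≤n ⟩
      blocks n ^ suc q                           ≡⟨ cong (_^ suc q) n∸seeds ⟨
      (n ∸ seedLength n) ^ suc q                 ≤⟨ m≤m*n _ (n ^ (p ∸ q)) {{m^n≢0 n (p ∸ q)}} ⟩
      (n ∸ seedLength n) ^ suc q * n ^ (p ∸ q)   ∎
      where instance _ = >-nonZero 1≤n

  -- At width 0, n is below 4^(q+1) and the additive `a` covers it, even with no seeds. Otherwise
  -- there are at most as many blocks as seeds, so n ≤ 2 s.
  n≤poly-seeds : ∀ n → let a = 4 ^ suc q in n ≤ a * seedLength n ^ a + a
  n≤poly-seeds n = byWidth (width n) refl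
    where
    a = 4 ^ suc q
    s = seedLength n
    2≤a : 2 ≤ a
    2≤a = ≤-trans (s≤s (s≤s z≤n)) (n≤n^suc 4 q)
    s≤s^ : ∀ a → 2 ≤ a → s ≤ s ^ a
    s≤s^ (suc a) _ = n≤n^suc s a
    byWidth : ∀ k → width n ≡ k → n ≤ a * s ^ a + a
    byWidth zero    eq =
      ≤-trans (<⇒≤ (subst (λ k → n < (2 * suc (suc k)) ^ suc q) eq (n<[2width]^ n))) (m≤n+m a (a * s ^ a))
    byWidth (suc k) eq = m≤n⇒m≤n+o a (begin
      n              ≡⟨ n≡seeds+blocks n ⟩
      s + blocks n   ≤⟨ +-monoʳ-≤ s blocks≤s ⟩
      s + s          ≡⟨ cong (s +_) (+-identityʳ s) ⟨
      2 * s          ≤⟨ *-mono-≤ 2≤a (s≤s^ a 2≤a) ⟩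
      a * s ^ a      ∎)
      where
      open ≤-Reasoning
      blocks≤s : blocks n ≤ s
      blocks≤s = subst (λ k → blocks n ≤ seeds (blocks n) k (rest n)) (sym eq)
                       (blocks≤seeds (blocks n) k (rest n))

-- Exponentials against polynomials.

suc-n≤2^n : ∀ n → suc n ≤ 2 ^ n
suc-n≤2^n zero    = s≤s z≤n
suc-n≤2^n (suc n) = begin
  suc (suc n)       ≤⟨ s≤s (m≤n+m _ n) ⟩
  suc n + suc n     ≤⟨ +-mono-≤ (suc-n≤2^n n) (suc-n≤2^n n) ⟩
  2 ^ n + 2 ^ n     ≡⟨ cong (2 ^ n +_) (+-identityʳ (2 ^ n)) ⟨
  2 ^ suc n         ∎
  where open ≤-Reasoning

-- Absorbing the coefficients into the exponent keeps each bound a pure power of `t`, so polynomial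
-- bounds can be chained.
poly≤power : ∀ {t x E} a → 2 ≤ t → x ≤ t ^ E → a * x ^ a + a ≤ t ^ (a + a + E * a)
poly≤power {t} {x} {E} a 2≤t x≤ = begin
  a * x ^ a + a                       ≤⟨ +-mono-≤ (*-monoʳ-≤ a (^-monoˡ-≤ a x≤)) (m≤m*n a ((t ^ E) ^ a)) ⟩
  a * (t ^ E) ^ a + a * (t ^ E) ^ a   ≡⟨ *-distribʳ-+ ((t ^ E) ^ a) a a ⟨
  (a + a) * (t ^ E) ^ a               ≤⟨ *-mono-≤ a+a≤ (≤-reflexive (^-*-assoc t E a)) ⟩
  t ^ (a + a) * t ^ (E * a)           ≡⟨ ^-distribˡ-+-* t (a + a) (E * a) ⟨
  t ^ (a + a + E * a)                 ∎
  where
  open ≤-Reasoning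
  instance
    t≢0 : NonZero t
    t≢0 = >-nonZero (≤-trans (s≤s z≤n) 2≤t)
    t^E≢0 : NonZero ((t ^ E) ^ a)
    t^E≢0 = m^n≢0 (t ^ E) a {{m^n≢0 t E}}
  a+a≤ : a + a ≤ t ^ (a + a)
  a+a≤ = ≤-trans (n≤1+n _) (≤-trans (suc-n≤2^n (a + a)) (^-monoˡ-≤ (a + a) 2≤t))

-- The power is the constant c of `power<exp`, bounded there crudely by 2^c. Of the added 3, two
-- cover the gap between `suc (suc k)` and `k`, and one gives strictness; the outer 2 balances u (e
-- + 1) ≤ t / 2.
expThreshold : ℕ → ℕ
expThreshold e = 2 * ((2 * suc e) ^ suc e + 3)

-- With d = 2 (e + 1) and u = t / d one has t ≤ d (u + 1) ≤ d 2ᵘ, hence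
-- t^(e+1) ≤ d^(e+1) 2^(u (e+1)), where u (e + 1) ≤ t / 2.
power<exp : ∀ e k → expThreshold e ≤ suc (suc k) → suc (suc k) ^ suc e < 2 ^ k
power<exp e k T≤t = begin-strict
  t ^ suc e                           ≤⟨ ^-monoˡ-≤ (suc e) t≤ ⟩
  (2 ^ u * d) ^ suc e                 ≡⟨ ^-distribʳ-* (2 ^ u) d (suc e) ⟩
  (2 ^ u) ^ suc e * c                 ≤⟨ *-mono-≤ (≤-reflexive (^-*-assoc 2 u (suc e)))
                                                  (≤-trans (n≤1+n c) (suc-n≤2^n c)) ⟩
  2 ^ (u * suc e) * 2 ^ c             ≡⟨ ^-distribˡ-+-* 2 (u * suc e) c ⟨
  2 ^ (u * suc e + c)                 <⟨ ^-monoʳ-< 2 (s≤s (s≤s z≤n)) exponent< ⟩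
  2 ^ k                               ∎
  where
  open ≤-Reasoning
  t = suc (suc k)
  d = 2 * suc e
  u = t / d
  c = d ^ suc e
  t≤ : t ≤ 2 ^ u * d
  t≤ = begin
    t                 ≡⟨ m≡m%n+[m/n]*n t d ⟩
    t % d + u * d     ≤⟨ +-monoˡ-≤ (u * d) (<⇒≤ (m%n<n t d)) ⟩
    suc u * d         ≤⟨ *-monoˡ-≤ d (suc-n≤2^n u) ⟩
    2 ^ u * d         ∎
  regroup : ∀ u e c → 2 * (u * suc e + c + 3) ≡ u * (2 * suc e) + 2 * (c + 3)
  regroup = solve-∀
  shift : ∀ x → x + 3 ≡ suc (suc (suc x))
  shift = solve-∀
  exponent< : u * suc e + c < k
  exponent< = s≤s⁻¹ (s≤s⁻¹ (subst (_≤ t) (shift (u * suc e + c)) (*-cancelˡ-≤ 2 (begin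
    2 * (u * suc e + c + 3)       ≡⟨ regroup u e c ⟩
    u * d + 2 * (c + 3)           ≤⟨ +-mono-≤ (m/n*n≤m t d) T≤t ⟩
    t + t                         ≡⟨ cong (t +_) (+-identityʳ t) ⟨
    2 * t                         ∎))))

-- The generator, its complexity and its hitting property.

module _ {c ℓ′ : Level} (F : Field c ℓ′) (q : ℕ) where
  open Layout q
  open Expansion F

  layoutGenerator : (n : ℕ) → Fin n → Expr F (seedLength n)
  layoutGenerator n = generator (layoutMap n)

  layoutGenerator-VNC⁰ : (i : (n : ℕ) → Fin (suc n)) →
    VNC⁰ F (λ n → seedLength (suc n)) (λ n → layoutGenerator (suc n) (i n))
  layoutGenerator-VNC⁰ i =
      ( (1 , λ n → ≤-trans (proj₁ (seedBound 0 (suc n))) (≤-reflexive (linear n)))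
      , (4 ^ suc q , λ n → ≤-trans (n≤1+n n) (n≤poly-seeds (suc n)))
      , (3 , λ n → _ , ≈-refl ,
           ≤-trans (≤-reflexive (synDeg-product (factors n))) (≤-trans (short n) (m≤n+m 3 (3 * n ^ 3)))))
    , 3 , λ n →
        let k , C , computes , size≤1 , fanIn≤3 = productCircuit (factors n) (short n)
        in  k , C , computes , ≤-trans size≤1 (s≤s z≤n) , fanIn≤3
    where
    factors = λ n → MonomialMap.factors (layoutMap (suc n)) (i n)
    short   = λ n → MonomialMap.factors-short (layoutMap (suc n)) (i n)
    linear : ∀ n → suc n ≡ 1 * n ^ 1 + 1
    linear n = trans (+-comm 1 n)
      (cong (_+ 1) (sym (trans (*-identityˡ (n ^ 1)) (^-identityʳ n))))

  -- With `t` the width plus 2, the number of variables, then n, then the degree are bounded by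
  -- powers of `t` with fixed exponents `E₀`, `E₁`, `E₂`. Once `t` is large, the last power is below
  -- 2^k.
  layoutGenerator-hits : (m : ℕ → ℕ) (f : (n : ℕ) → Expr F (m n)) → IsPFamily F m f →
    ∃[ N ] (∀ n → N ≤ n → substₚ F (f n) (layoutGenerator (m n)) ≋ 0ₚ F → f n ≋ 0ₚ F)
  layoutGenerator-hits m f (_ , (a₁ , n≤) , (a₂ , deg≤)) = suc (T ^ E₁) , hits
    where
    open ≤-Reasoning
    E₀ = 2 * suc q
    E₁ = a₁ + a₁ + E₀ * a₁
    E₂ = a₂ + a₂ + E₁ * a₂
    T  = expThreshold E₂

    hits : ∀ n → suc (T ^ E₁) ≤ n → substₚ F (f n) (layoutGenerator (m n)) ≋ 0ₚ F → f n ≋ 0ₚ F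
    hits n N≤n fG≋0 with deg≤ n
    -- The degree bound holds for the representative `e`, not for the expression `f n`, so vanishing
    -- is carried over to `e` and back.
    ... | e , e≋f , degₑ≤ =
      ≈-trans (≈-sym e≋f) (generator-hits (layoutMap (m n)) e degₑ<
        (≈-trans (substₚ-cong (layoutGenerator (m n)) e≋f) fG≋0))
      where
      k = width (m n)
      t = suc (suc k)
      2≤t : 2 ≤ t
      2≤t = s≤s (s≤s z≤n)
      m≤t^ : m n ≤ t ^ E₀
      m≤t^ = begin
        m n              ≤⟨ <⇒≤ (n<[2width]^ (m n)) ⟩
        (2 * t) ^ suc q  ≤⟨ ^-monoˡ-≤ (suc q) (*-mono-≤ 2≤t (≤-reflexive (sym (*-identityʳ t)))) ⟩
        (t ^ 2) ^ suc q  ≡⟨ ^-*-assoc t 2 (suc q) ⟩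
        t ^ E₀           ∎
      n≤t^ : n ≤ t ^ E₁
      n≤t^ = ≤-trans (n≤ n) (poly≤power {E = E₀} a₁ 2≤t m≤t^)
      -- The choice of the threshold on n acts here: `t` below `T` would give n ≤ `T ^ E₁`. Thus the
      -- width grows with n.
      T≤t : T ≤ t
      T≤t with T ≤? t
      ... | yes T≤t = T≤t
      ... | no  T≰t = contradiction (≤-trans n≤t^ (^-monoˡ-≤ E₁ (<⇒≤ (≰⇒> T≰t)))) (<⇒≱ N≤n)
      degₑ< : synDeg F e < 2 ^ k
      degₑ< = begin-strict
        synDeg F e          ≤⟨ degₑ≤ ⟩
        a₂ * n ^ a₂ + a₂    ≤⟨ poly≤power {E = E₁} a₂ 2≤t n≤t^ ⟩
        t ^ E₂              ≤⟨ ^-monoʳ-≤ t (n≤1+n E₂) ⟩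
        t ^ suc E₂          <⟨ power<exp E₂ k T≤t ⟩
        2 ^ k               ∎

theorem4p3 : ∀ {c ℓ' : Level} (F : Field c ℓ') → CharZero F →
    (p q : ℕ) → 1 ≤ p → 1 ≤ q →
    Σ (ℕ → ℕ) λ ℓ → Σ ((n : ℕ) → Fin n → Expr F (ℓ n)) λ G →
    SeedBound p q ℓ × IsVNC⁰HSGforVAC⁰ F ℓ G
theorem4p3 F _ (suc p) (suc q) _ _ =
    Layout.seedLength q , layoutGenerator F q , Layout.seedBound q p
  , layoutGenerator-VNC⁰ F q
  , λ m f (pFamily , _) →
      let N , hits = layoutGenerator-hits F q m f pFamily
      -- The converse direction is congruence of substitution, which fixes the constant zero.
      in  N , λ n N≤n → hits n N≤n , Expansion.substₚ-cong F (layoutGenerator F q (m n))
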